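{- For every $n\ge 0$ and every Ferrers board $F\in\mathcal{F}_n$ there are explicit bijections $$\Delta_{321}:\mathcal{M}_F(321)\to\mathcal{D}^2_F\qquad\text{and}\qquad \Delta_{213}:\mathcal{M}_F(213)\to\mathcal{D}^2_F .$$ Consequently $|\mathcal{M}_F(321)|=|\mathcal{M}_F(213)|$ for every Ferrers board $F$, i.e. the patterns $321$ and $213$ are shape-Wilf-equivalent.
   Context: A Dyck path of semilength $n$ is a lattice path from $(0,n)$ to $(n,0)$ using unit east steps $(1,0)$ and south steps $(0,-1)$ that never goes strictly below the line $y=n-x$; $\mathcal{D}_n$ denotes the set of them. For $D\in\mathcal{D}_n$, the Ferrers board with border $D$ is the set of unit squares of $[0,n]^2$ lying below $D$ (between $D$ and the coordinate axes); $\mathcal{F}_n$ is the set of these boards and, for $F\in\mathcal{F}_n$, $D_F$ denotes its border path. $\mathcal{D}^2_F$ is the set of pairs $(D_0,D_F)$ with $D_0\in\mathcal{D}_n$ never going strictly above $D_F$. A perfect matching of $[2n]$ is a set of $n$ disjoint pairs $(i,j)$, $i<j$, covering $[2n]$; $i$ is an opener and $j$ a closer. The shape of a matching $M$ of $[2n]$ is the board in $\mathcal{F}_n$ whose border is obtained by reading $1,2,\dots,2n$ and taking an east step for each opener and a south step for each closer. A matching $M$ avoids $\tau\in S_k$ if there are no $i_1<\dots<i_{2k}$ such that $M$ contains all pairs $(i_a,i_{2k+1-\tau(a)})$, $1\le a\le k$. $\mathcal{M}_F(\tau)$ is the set of $\tau$-avoiding perfect matchings of shape $F$. Full rook placements: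 a full rook placement on $F\in\mathcal{F}_n$ is a set $R$ of unit squares of $F$ containing exactly one square in each of the $n$ rows and $n$ columns. For a lattice point $V=(a,b)$, $\Gamma(V)$ is the set of unit squares in $[0,a]\times[0,b]$. A set of squares with at most one per row and column determines a permutation by deleting empty rows/columns and recording, from left to right, the row ranks of the squares. $(R,F)$ avoids $\tau$ if for every vertex $V$ of the border of $F$ the permutation determined by $R\cap\Gamma(V)$ avoids $\tau$ in the usual sense. Two patterns $\sigma,\tau$ are shape-Wilf-equivalent if for every Ferrers board $F$ the numbers of full rook placements on $F$ avoiding $\sigma$ and avoiding $\tau$ coincide; via the natural bijection between matchings of shape $F$ and full rook placements on $F$ (a pair $(i,j)$ gives a rook in the column of opener $i$ and the row of closer $j$), this is the same as $|\mathcal{M}_F(\sigma)|=|\mathcal{M}_F(\tau)|$ for all $F$. -}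

module Defs where

open import Data.Nat using (ℕ; zero; suc; _+_; _≤_)
open import Data.Fin as Fin using (Fin; zero; suc; _↑ˡ_; opposite; _<?_)
open import Data.Vec using (Vec; lookup; tabulate; toList; _∷_; [])
open import Data.List using (List; []; _∷_; take; length)
open import Data.Product using (Σ; _×_)
open import Data.Refinement using (Refinement-syntax; value)
open import Relation.Nullary using (¬_; does)
open import Relation.Binary.PropositionalEquality using (_≡_; _≢_)
open import Data.Bool using (if_then_else_)
open import Function.Bundles using (_⤖_)

data Step : Set where
  E S : Step

easts : List Step → ℕ
easts []       = 0
easts (E ∷ w)  = suc (easts w)
easts (S ∷ w)  = easts w

souths : List Step → ℕ
souths []       = 0
souths (E ∷ w)  = souths w
souths (S ∷ w)  = suc (souths w)

-- A path from (0,n) to (n,0) with east/south steps (n east and n south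
-- steps) never going strictly below y = n - x: after e east and s south
-- steps the path is at (e, n - s), so the condition is s ≤ e for every prefix.
IsDyck : ℕ → List Step → Set
IsDyck n w = (length w ≡ n + n) × (easts w ≡ n)
           × (∀ k → souths (take k w) ≤ easts (take k w))

-- 𝒟_n  (proofs are irrelevant, so equality is equality of the paths)
Dyck : ℕ → Set
Dyck n = [ w ∈ List Step ∣ IsDyck n w ]

-- 𝓕_n : a Ferrers board F ∈ 𝓕_n is determined by (and here represented
-- by) its border path D_F ∈ 𝒟_n.
Ferrers : ℕ → Set
Ferrers = Dyck

borderPath : ∀ {n} → Ferrers n → Dyck n
borderPath F = F

-- D₀ never goes strictly above D: after k steps both paths lie on the line
-- x - y = k - n, and D₀ is weakly below D iff D₀ has made at most as many
-- east steps as D.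
NotAbove : List Step → List Step → Set
NotAbove w₀ w = ∀ k → easts (take k w₀) ≤ easts (take k w)

D² : (n : ℕ) → Ferrers n → Set
D² n F = [ p ∈ Dyck n × Dyck n ∣
           (Data.Product.proj₂ p ≡ borderPath F)
           × NotAbove (value (Data.Product.proj₁ p)) (value (Data.Product.proj₂ p)) ]

-- Perfect matchings of [2n] (points indexed 0 … 2n-1), encoded as the
-- fixed-point-free involution i ↦ partner of i.  (i , j) ∈ M with i < j
-- iff partner i ≡ j.

IsPerfectMatching : ∀ {N} → Vec (Fin N) N → Set
IsPerfectMatching {N} m = (∀ i → lookup m (lookup m i) ≡ i) × (∀ i → lookup m i ≢ i)

shapeWord : ∀ {N} → Vec (Fin N) N → List Step
shapeWord m = toList (tabulate (λ i → if does (i <? lookup m i) then E else S))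

-- M contains τ ∈ S_k: there are positions i₀ < … < i_{2k-1} (0-indexed)
-- such that (i_a , i_{2k-1-τ(a)}) ∈ M for all a (this is the paper's
-- (i_a , i_{2k+1-τ(a)}) with 1-indexing).
Contains : ∀ {N k} → Vec (Fin N) N → (Fin k → Fin k) → Set
Contains {N} {k} m τ =
  Σ (Fin (k + k) → Fin N) λ f →
    (∀ i j → i Fin.< j → f i Fin.< f j)
    × (∀ a → lookup m (f (a ↑ˡ k)) ≡ f (opposite (τ a ↑ˡ k)))

Avoids : ∀ {N k} → Vec (Fin N) N → (Fin k → Fin k) → Set
Avoids m τ = ¬ Contains m τ

ℳ : (n : ℕ) → Ferrers n → ∀ {k} → (Fin k → Fin k) → Set
ℳ n F τ = [ m ∈ Vec (Fin (n + n)) (n + n) ∣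
            IsPerfectMatching m × (shapeWord m ≡ value (borderPath F)) × Avoids m τ ]

τ321 : Fin 3 → Fin 3
τ321 = lookup (suc (suc zero) ∷ suc zero ∷ zero ∷ [])

τ213 : Fin 3 → Fin 3
τ213 = lookup (suc zero ∷ zero ∷ suc (suc zero) ∷ [])

ShapeWilfEquivalent : ∀ {k} → (Fin k → Fin k) → (Fin k → Fin k) → Set
ShapeWilfEquivalent σ τ = ∀ n (F : Ferrers n) → ℳ n F σ ⤖ ℳ n F τ

{-# OPTIONS --safe #-}

-- Read the shape F from left to right, with h arcs currently open, and regard
-- the rest of the matching as a matching of shape Eʰ w.  An opener leaves this
-- matching unchanged; at a closer (position h from 0, with h = k + 1) whose
-- partner is p ≤ k, delete the arc {p , k + 1}.  In parallel, D₀ is treated as a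
-- path lying under Eʰ w: at such a closer a peak ES is deleted from its positions
-- p , p + 1.  Every peak of D₀ starting at p ≤ k may be deleted in this way, so D₀
-- determines the matching once a choice of peak is prescribed.
-- Always choosing the last such peak yields exactly the matchings avoiding 321:
-- deleting {p , k + 1} forces the arcs opened after p to be closed in decreasing
-- order, and in D₀ ascents of f on the open arcs correspond to peaks.  Always
-- choosing the first peak yields those avoiding 213: now the arcs opened before p
-- must be closed in decreasing order, which means that D₀ starts with Eᵖ.
module Submission where

open import Defs
open import Data.Bool using (if_then_else_)
open import Data.Empty using (⊥; ⊥-elim)
open import Data.Fin as Fin using (Fin; toℕ; fromℕ<; _↑ˡ_; opposite; #_)
import Data.Fin.Properties as Fin
open import Data.Irrelevant using ([_])
open import Data.List using (List; []; _∷_; length; take; replicate; _++_)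
import Data.List.Properties as List
open import Data.Maybe as Maybe using (Maybe; just; nothing; maybe′)
open import Data.Nat
open import Data.Nat.Properties
open import Data.Product as Product using (∃; _×_; _,_; proj₁; proj₂)
open import Data.Refinement using (value; _,_)
open import Data.Refinement.Properties using (value-injective)
open import Data.Sum using (_⊎_; inj₁; inj₂)
open import Data.Unit using (⊤; tt)
open import Data.Vec as Vec using (Vec; lookup; tabulate; toList)
open import Data.Vec.Properties as Vec using (lookup∘tabulate; tabulate∘lookup; tabulate-cong)
open import Data.Vec.Relation.Unary.Linked using (Linked; [-]; _∷_)
open import Data.Vec.Relation.Unary.Linked.Properties using (lookup⁺)
open import Function using (_∘_; id)
open import Function.Bundles using (_⤖_; _⇔_; mk⇔; Equivalence; _↔_; mk↔ₛ′)
open import Function.Properties.Inverse using (↔⇒⤖; ↔-sym; ↔-trans)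
open import Relation.Binary.Definitions using (DecidableEquality; tri<; tri≈; tri>)
open import Relation.Binary.PropositionalEquality
open import Relation.Nullary using (¬_; Dec; yes; no; contradiction)
open import Relation.Nullary.Decidable using (recompute; does)

-- Inserting an arc into a matching

punchIn : ℕ → ℕ → ℕ
punchIn zero    y       = suc y
punchIn (suc p) zero    = zero
punchIn (suc p) (suc y) = suc (punchIn p y)

punchOut : ℕ → ℕ → ℕ
-- At the excluded position `x ≡ p` the value is a mere default.
punchOut zero    x       = pred x
punchOut (suc p) zero    = zero
punchOut (suc p) (suc x) = suc (punchOut p x)

punchOut-punchIn : ∀ p y → punchOut p (punchIn p y) ≡ y
punchOut-punchIn zero    y       = refl
punchOut-punchIn (suc p) zero    = refl
punchOut-punchIn (suc p) (suc y) = cong suc (punchOut-punchIn p y)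

punchIn-punchOut : ∀ p x → x ≢ p → punchIn p (punchOut p x) ≡ x
punchIn-punchOut zero    zero    x≢p = contradiction refl x≢p
punchIn-punchOut zero    (suc x) x≢p = refl
punchIn-punchOut (suc p) zero    x≢p = refl
punchIn-punchOut (suc p) (suc x) x≢p = cong suc (punchIn-punchOut p x (x≢p ∘ cong suc))

punchIn≢ : ∀ p y → punchIn p y ≢ p
punchIn≢ (suc p) (suc y) eq = punchIn≢ p y (suc-injective eq)

punchIn-mono-< : ∀ p {x y} → x < y → punchIn p x < punchIn p y
punchIn-mono-< zero    x<y                         = s<s x<y
punchIn-mono-< (suc p) {zero}  {suc y} x<y         = z<s
punchIn-mono-< (suc p) {suc x} {suc y} (s<s x<y)   = s<s (punchIn-mono-< p x<y)

punchIn-below : ∀ p {y} → y < p → punchIn p y ≡ y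
punchIn-below (suc p) {zero}  y<p       = refl
punchIn-below (suc p) {suc y} (s<s y<p) = cong suc (punchIn-below p y<p)

punchIn-above : ∀ p {y} → p ≤ y → punchIn p y ≡ suc y
punchIn-above zero    p≤y               = refl
punchIn-above (suc p) {suc y} (s≤s p≤y) = cong suc (punchIn-above p p≤y)

-- The increasing enumeration of ℕ ∖ {p , k + 1}, for p ≤ k.
skip : ℕ → ℕ → ℕ → ℕ
skip p k y = punchIn (suc k) (punchIn p y)

unskip : ℕ → ℕ → ℕ → ℕ
unskip p k x = punchOut p (punchOut (suc k) x)

unskip-skip : ∀ p k y → unskip p k (skip p k y) ≡ y
unskip-skip p k y = trans (cong (punchOut p) (punchOut-punchIn (suc k) (punchIn p y))) (punchOut-punchIn p y)

skip-mono-< : ∀ p k {x y} → x < y → skip p k x < skip p k y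
skip-mono-< p k = punchIn-mono-< (suc k) ∘ punchIn-mono-< p

skip-cancel-< : ∀ p k {x y} → skip p k x < skip p k y → x < y
skip-cancel-< p k {x} {y} lt with <-cmp x y
... | tri< x<y _ _  = x<y
... | tri≈ _ refl _ = contradiction lt (<-irrefl refl)
... | tri> _ _ y<x  = contradiction lt (<-asym (skip-mono-< p k y<x))

skip-injective : ∀ p k {x y} → skip p k x ≡ skip p k y → x ≡ y
skip-injective p k {x} {y} eq =
  trans (sym (unskip-skip p k x)) (trans (cong (unskip p k) eq) (unskip-skip p k y))

skip≢1+k : ∀ p k y → skip p k y ≢ suc k
skip≢1+k p k y = punchIn≢ (suc k) (punchIn p y)

module _ {p k : ℕ} (p≤k : p ≤ k) where

  skip≢p : ∀ y → skip p k y ≢ p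
  skip≢p y eq = punchIn≢ p y (begin
    punchIn p y                           ≡⟨ punchOut-punchIn (suc k) (punchIn p y) ⟨
    punchOut (suc k) (skip p k y)         ≡⟨ cong (punchOut (suc k)) skip≡ ⟩
    punchOut (suc k) (punchIn (suc k) p)  ≡⟨ punchOut-punchIn (suc k) p ⟩
    p                                     ∎)
    where
    open ≡-Reasoning
    skip≡ = trans eq (sym (punchIn-below (suc k) (s≤s p≤k)))

  skip-unskip : ∀ {x} → x ≢ p → x ≢ suc k → skip p k (unskip p k x) ≡ x
  skip-unskip {x} x≢p x≢k = begin
    skip p k (unskip p k x)               ≡⟨ cong (punchIn (suc k)) (punchIn-punchOut p _ out≢p) ⟩
    punchIn (suc k) (punchOut (suc k) x)  ≡⟨ punchIn-punchOut (suc k) x x≢k ⟩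
    x                                     ∎
    where
    open ≡-Reasoning
    out≢p : punchOut (suc k) x ≢ p
    out≢p eq = x≢p (trans (sym (punchIn-punchOut (suc k) x x≢k))
                 (trans (cong (punchIn (suc k)) eq) (punchIn-below (suc k) (s≤s p≤k))))

  skip-low : ∀ {y} → y < p → skip p k y ≡ y
  skip-low y<p rewrite punchIn-below p y<p = punchIn-below (suc k) (<-≤-trans y<p (m≤n⇒m≤1+n p≤k))

  skip-mid : ∀ {y} → p ≤ y → y < k → skip p k y ≡ suc y
  skip-mid p≤y y<k rewrite punchIn-above p p≤y = punchIn-below (suc k) (s<s y<k)

  skip-high : ∀ {y} → k ≤ y → skip p k y ≡ 2 + y
  skip-high k≤y rewrite punchIn-above p (≤-trans p≤k k≤y) = punchIn-above (suc k) (s≤s k≤y)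

  skip-≤ : ∀ {y} → y < k → skip p k y < suc k
  skip-≤ {y} y<k with <-≤-connex y p
  ... | inj₁ y<p rewrite skip-low y<p = m<n⇒m<1+n y<k
  ... | inj₂ p≤y rewrite skip-mid p≤y y<k = s<s y<k

  skip-≥ : ∀ {y} → k ≤ y → suc k < skip p k y
  skip-≥ k≤y rewrite skip-high k≤y = s<s (s≤s k≤y)

  skip>p : ∀ {y} → p ≤ y → p < skip p k y
  skip>p {y} p≤y with <-≤-connex y k
  ... | inj₁ y<k rewrite skip-mid p≤y y<k = s≤s p≤y
  ... | inj₂ k≤y rewrite skip-high k≤y = s≤s (m≤n⇒m≤1+n p≤y)

  skip>p⁻¹ : ∀ {y} → p < skip p k y → p ≤ y
  skip>p⁻¹ {y} lt with <-≤-connex y p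
  ... | inj₁ y<p rewrite skip-low y<p = <⇒≤ lt
  ... | inj₂ p≤y = p≤y

  skip<k⁻¹ : ∀ {y} → skip p k y < suc k → y < k
  skip<k⁻¹ {y} lt with <-≤-connex y k
  ... | inj₁ y<k = y<k
  ... | inj₂ k≤y = contradiction lt (<-asym (skip-≥ k≤y))

  skip-bound : ∀ {N y} → k ≤ N → y < N → skip p k y < 2 + N
  skip-bound {N} k≤N y<N = subst (_ <_) (skip-high k≤N) (skip-mono-< p k y<N)

  skip-bound⁻¹ : ∀ {N y} → k ≤ N → skip p k y < 2 + N → y < N
  skip-bound⁻¹ {N} k≤N lt = skip-cancel-< p k (subst (_ <_) (sym (skip-high k≤N)) lt)

data Dir (f : ℕ → ℕ) (x : ℕ) : Step → Set where
  up   : x < f x → Dir f x E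
  down : ¬ x < f x → Dir f x S

Word : (ℕ → ℕ) → ℕ → List Step → Set
Word f x []      = ⊤
Word f x (s ∷ w) = Dir f x s × Word f (suc x) w

-- Mat N h w f: on {0, …, N - 1} the function f is a perfect matching whose
-- shape is the word Eʰ w.
record Mat (N h : ℕ) (w : List Step) (f : ℕ → ℕ) : Set where
  field
    size  : N ≡ h + length w
    bound : ∀ {x} → x < N → f x < N
    invol : ∀ {x} → x < N → f (f x) ≡ x
    nofix : ∀ {x} → x < N → f x ≢ x
    open≥ : ∀ {x} → x < h → h ≤ f x
    word  : Word f h w

  inj : ∀ {x y} → x < N → y < N → f x ≡ f y → x ≡ y
  inj x<N y<N eq = trans (sym (invol x<N)) (trans (cong f eq) (invol y<N))

  h≤N : h ≤ N
  h≤N = subst (h ≤_) (sym size) (m≤m+n h (length w))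

matE : ∀ {N h w f} → Mat N h (E ∷ w) f → Mat N (suc h) w f
matE {N} {h} {w} {f} M with Mat.word M
... | up h<fh , ws = record
  { size  = trans size (+-suc h (length w)) ; bound = bound ; invol = invol ; nofix = nofix
  ; open≥ = open′ ; word = ws }
  where
  open Mat M
  open′ : ∀ {x} → x < suc h → suc h ≤ f x
  open′ {x} x<1+h with m≤n⇒m<n∨m≡n (s≤s⁻¹ x<1+h)
  ... | inj₂ refl = h<fh
  -- If `f x ≡ h`, then `f h ≡ x < h`, although `h` is an opener.
  ... | inj₁ x<h = ≤∧≢⇒< (open≥ x<h) λ h≡fx →
    <-asym h<fh (subst (_< h) (trans (sym (invol (<-≤-trans x<h h≤N))) (sym (cong f h≡fx))) x<h)

matE⁻¹ : ∀ {N h w f} → Mat N (suc h) w f → Mat N h (E ∷ w) f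
matE⁻¹ {N} {h} {w} {f} M = record
  { size  = trans size (sym (+-suc h (length w))) ; bound = bound ; invol = invol ; nofix = nofix
  ; open≥ = λ x<h → <⇒≤ (open≥ (m<n⇒m<1+n x<h)) ; word = up (open≥ ≤-refl) , word }
  where open Mat M

-- f arises from f′ by inserting the arc {p , k + 1}.
record Ext (N p k : ℕ) (f f′ : ℕ → ℕ) : Set where
  field
    p≤k    : p ≤ k
    k≤N    : k ≤ N
    closer : f (suc k) ≡ p
    opener : f p ≡ suc k
    rest   : ∀ {y} → y < N → f (skip p k y) ≡ skip p k (f′ y)

data View (N p k : ℕ) : ℕ → Set where
  isP   : View N p k p
  isK   : View N p k (suc k)
  other : ∀ {y} → y < N → View N p k (skip p k y)

view : ∀ {N p k x} → p ≤ k → k ≤ N → x < 2 + N → View N p k x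
view {N} {p} {k} {x} p≤k k≤N x<N with x ≟ p | x ≟ suc k
... | yes refl | _        = isP
... | no _     | yes refl = isK
... | no x≢p   | no x≢k   = subst (View N p k) eq (other (skip-bound⁻¹ p≤k k≤N (subst (_< 2 + N) (sym eq) x<N)))
  where eq = skip-unskip p≤k x≢p x≢k

module _ {N p k f f′} (X : Ext N p k f f′) where
  open Ext X

  private
    position-bound : ∀ {y} l → y + suc l ≤ N → y < N
    position-bound {y} l le = ≤-trans (s≤s (m≤m+n y l)) (≤-trans (≤-reflexive (sym (+-suc y l))) le)

  -- Past the closer `skip p k` is a shift by two, and being strictly increasing it keeps the
  -- direction of every arc; so the remaining letters do not change.
  word-ext : ∀ {y} w → k ≤ y → y + length w ≤ N → Word f (2 + y) w → Word f′ y w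
  word-ext []      k≤y le ws       = tt
  word-ext {y} (s ∷ w) k≤y le (d , ws) =
    dir d , word-ext w (m≤n⇒m≤1+n k≤y) (subst (_≤ N) (+-suc y (length w)) le) ws
    where
    y<N = position-bound (length w) le
    dir : ∀ {s} → Dir f (2 + y) s → Dir f′ y s
    dir d with d | subst (λ z → f z ≡ skip p k (f′ y)) (skip-high p≤k k≤y) (rest y<N)
    ... | up lt  | eq = up (skip-cancel-< p k (subst₂ _<_ (sym (skip-high p≤k k≤y)) eq lt))
    ... | down n | eq = down λ lt → n (subst₂ _<_ (skip-high p≤k k≤y) (sym eq) (skip-mono-< p k lt))

  word-ext⁻¹ : ∀ {y} w → k ≤ y → y + length w ≤ N → Word f′ y w → Word f (2 + y) w
  word-ext⁻¹ []      k≤y le ws       = tt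
  word-ext⁻¹ {y} (s ∷ w) k≤y le (d , ws) =
    dir d , word-ext⁻¹ w (m≤n⇒m≤1+n k≤y) (subst (_≤ N) (+-suc y (length w)) le) ws
    where
    y<N = position-bound (length w) le
    dir : ∀ {s} → Dir f′ y s → Dir f (2 + y) s
    dir d with d | subst (λ z → f z ≡ skip p k (f′ y)) (skip-high p≤k k≤y) (rest y<N)
    ... | up lt  | eq = up (subst₂ _<_ (skip-high p≤k k≤y) (sym eq) (skip-mono-< p k lt))
    ... | down n | eq = down λ lt → n (skip-cancel-< p k (subst₂ _<_ (sym (skip-high p≤k k≤y)) eq lt))

  mat-ext : ∀ {w} → Mat (2 + N) (suc k) (S ∷ w) f → Mat N k w f′
  mat-ext {w} M = record
    { size = size′ ; bound = bound′ ; invol = invol′ ; nofix = nofix′ ; open≥ = open′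
    ; word = word-ext w ≤-refl (≤-reflexive (sym size′)) (proj₂ word) }
    where
    open Mat M
    size′ : N ≡ k + length w
    size′ = suc-injective (trans (suc-injective size) (+-suc k (length w)))
    bound′ : ∀ {x} → x < N → f′ x < N
    bound′ x<N = skip-bound⁻¹ p≤k k≤N (subst (_< 2 + N) (rest x<N) (bound (skip-bound p≤k k≤N x<N)))
    invol′ : ∀ {x} → x < N → f′ (f′ x) ≡ x
    invol′ {x} x<N = skip-injective p k (begin
      skip p k (f′ (f′ x))  ≡⟨ rest (bound′ x<N) ⟨
      f (skip p k (f′ x))   ≡⟨ cong f (rest x<N) ⟨
      f (f (skip p k x))    ≡⟨ invol (skip-bound p≤k k≤N x<N) ⟩
      skip p k x            ∎)
      where open ≡-Reasoning
    nofix′ : ∀ {x} → x < N → f′ x ≢ x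
    nofix′ x<N eq = nofix (skip-bound p≤k k≤N x<N) (trans (rest x<N) (cong (skip p k) eq))
    open′ : ∀ {x} → x < k → k ≤ f′ x
    open′ x<k = ≮⇒≥ λ fx<k → <⇒≱ (skip-≤ p≤k fx<k)
      (subst (suc k ≤_) (rest (<-≤-trans x<k k≤N)) (open≥ (skip-≤ p≤k x<k)))

  mat-ext⁻¹ : ∀ {w} → Mat N k w f′ → Mat (2 + N) (suc k) (S ∷ w) f
  mat-ext⁻¹ {w} M = record
    { size = cong suc (trans (cong suc size) (sym (+-suc k (length w))))
    ; bound = bound′ ∘ view p≤k k≤N ; invol = invol′ ∘ view p≤k k≤N ; nofix = nofix′ ∘ view p≤k k≤N
    ; open≥ = λ x<k → open′ x<k (view p≤k k≤N (<-≤-trans x<k (s≤s (m≤n⇒m≤1+n k≤N))))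
    ; word = down (λ lt → <⇒≱ lt (≤-trans (≤-reflexive closer) (m≤n⇒m≤1+n p≤k)))
           , word-ext⁻¹ w ≤-refl (≤-reflexive (sym size)) word }
    where
    open Mat M
    bound′ : ∀ {x} → View N p k x → f x < 2 + N
    bound′ isP rewrite opener = s<s (s≤s k≤N)
    bound′ isK rewrite closer = s≤s (m≤n⇒m≤1+n (≤-trans p≤k k≤N))
    bound′ (other y<N) rewrite rest y<N = skip-bound p≤k k≤N (bound y<N)
    invol′ : ∀ {x} → View N p k x → f (f x) ≡ x
    invol′ isP rewrite opener = closer
    invol′ isK rewrite closer = opener
    invol′ (other y<N) rewrite rest y<N | rest (bound y<N) = cong (skip p k) (invol y<N)
    nofix′ : ∀ {x} → View N p k x → f x ≢ x
    nofix′ isP eq = <⇒≢ (s≤s p≤k) (trans (sym eq) opener)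
    nofix′ isK eq = <⇒≢ (s≤s p≤k) (trans (sym closer) eq)
    nofix′ (other y<N) eq = nofix y<N (skip-injective p k (trans (sym (rest y<N)) eq))
    open′ : ∀ {x} → x < suc k → View N p k x → suc k ≤ f x
    open′ lt isP rewrite opener = ≤-refl
    open′ lt isK = contradiction lt (<-irrefl refl)
    open′ lt (other y<N) rewrite rest y<N = <⇒≤ (skip-≥ p≤k (open≥ (skip<k⁻¹ p≤k lt)))

delArc : ℕ → ℕ → (ℕ → ℕ) → ℕ → ℕ
delArc p k f = unskip p k ∘ f ∘ skip p k

insArc : ℕ → ℕ → (ℕ → ℕ) → ℕ → ℕ
insArc p k f x with x ≟ suc k | x ≟ p
... | yes _ | _     = p
... | no _  | yes _ = suc k
... | no _  | no _  = skip p k (f (unskip p k x))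

ins-ext : ∀ {N p k} f → p ≤ k → k ≤ N → Ext N p k (insArc p k f) f
ins-ext {N} {p} {k} f p≤k k≤N = record
  { p≤k = p≤k ; k≤N = k≤N ; closer = closer ; opener = opener ; rest = λ _ → rest _ }
  where
  closer : insArc p k f (suc k) ≡ p
  closer with suc k ≟ suc k
  ... | yes _ = refl
  ... | no ne = contradiction refl ne
  opener : insArc p k f p ≡ suc k
  opener with p ≟ suc k | p ≟ p
  ... | yes eq | _     = contradiction p≤k (<⇒≱ (≤-reflexive (sym eq)))
  ... | no _   | yes _ = refl
  ... | no _   | no ne = contradiction refl ne
  rest : ∀ y → insArc p k f (skip p k y) ≡ skip p k (f y)
  rest y with skip p k y ≟ suc k | skip p k y ≟ p
  ... | yes eq | _      = contradiction eq (skip≢1+k p k y)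
  ... | no _   | yes eq = contradiction eq (skip≢p p≤k y)
  ... | no _   | no _   = cong (skip p k ∘ f) (unskip-skip p k y)

-- The letter `S` makes `k + 1` a closer, so its partner is at most `k`. An involution maps
-- positions off the arc to positions off the arc, where `unskip` loses nothing.
del-ext : ∀ {N k w f} → Mat (2 + N) (suc k) (S ∷ w) f → Ext N (f (suc k)) k f (delArc (f (suc k)) k f)
del-ext {N} {k} {w} {f} M with Mat.word M
... | down nlt , _ = record { p≤k = p≤k ; k≤N = k≤N ; closer = refl ; opener = opener ; rest = rest }
  where
  open Mat M
  p = f (suc k)
  k≤N : k ≤ N
  k≤N = ≤-trans (m≤m+n k (length w))
        (≤-reflexive (sym (suc-injective (trans (suc-injective size) (+-suc k (length w))))))
  k<N : suc k < 2 + N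
  k<N = s<s (s≤s k≤N)
  p≤k : p ≤ k
  p≤k = s≤s⁻¹ (≤∧≢⇒< (≮⇒≥ nlt) (nofix k<N))
  opener : f p ≡ suc k
  opener = invol k<N
  rest : ∀ {y} → y < N → f (skip p k y) ≡ skip p k (delArc p k f y)
  rest {y} y<N = sym (skip-unskip p≤k
    (λ eq → skip≢1+k p k y (trans (sym (invol lt)) (trans (cong f eq) opener)))
    (λ eq → skip≢p p≤k y (trans (sym (invol lt)) (cong f eq))))
    where
    lt : skip p k y < 2 + N
    lt = skip-bound p≤k k≤N y<N

-- Each position is an end of the new arc or the image of an old position, and `Ext` prescribes the
-- value in every case.
ext-unique : ∀ {N p k f g f′ g′} → Ext N p k f f′ → Ext N p k g g′ →
             (∀ {y} → y < N → f′ y ≡ g′ y) → ∀ {x} → x < 2 + N → f x ≡ g x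
ext-unique {N} {p} {k} {f} {g} X Y eq x<N = go (view X.p≤k X.k≤N x<N)
  where
  module X = Ext X
  module Y = Ext Y
  go : ∀ {x} → View N p k x → f x ≡ g x
  go isP         = trans X.opener (sym Y.opener)
  go isK         = trans X.closer (sym Y.closer)
  go (other y<N) = trans (X.rest y<N) (trans (cong (skip p k) (eq y<N)) (sym (Y.rest y<N)))

-- Inserting a peak into a path

-- The index is the excess of east over south steps before the word starts. `Ballot 0` describes
-- Dyck paths; `Ballot h w` describes the rest of a border with `h` arcs open.
data Ballot : ℕ → List Step → Set where
  []   : Ballot 0 []
  up   : ∀ {d l} → Ballot (suc d) l → Ballot d (E ∷ l)
  down : ∀ {d l} → Ballot d l → Ballot (suc d) (S ∷ l)

-- Under s D F: the path D, which starts s diagonals below the start of F,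
-- never goes above F and has the same length.
data Under : ℕ → List Step → List Step → Set where
  []   : ∀ {s} → Under s [] []
  same : ∀ {s x D F} → Under s D F → Under s (x ∷ D) (x ∷ F)
  fall : ∀ {s D F} → Under (suc s) D F → Under s (S ∷ D) (E ∷ F)
  rise : ∀ {s D F} → Under s D F → Under (suc s) (E ∷ D) (S ∷ F)

insPeak : ℕ → List Step → List Step
insPeak zero    T       = E ∷ S ∷ T
-- Default for `p` beyond the end of the path: the peak is appended, so the length still grows by
-- two.
insPeak (suc p) []      = E ∷ S ∷ []
insPeak (suc p) (x ∷ T) = x ∷ insPeak p T

length-insPeak : ∀ p T → length (insPeak p T) ≡ 2 + length T
length-insPeak zero    T       = refl
length-insPeak (suc p) []      = refl
length-insPeak (suc p) (x ∷ T) = cong suc (length-insPeak p T)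

ballot-ins : ∀ {d} p T → Ballot d T → Ballot d (insPeak p T)
ballot-ins zero    T       b        = up (down b)
ballot-ins (suc p) []      b        = up (down b)
ballot-ins (suc p) (E ∷ T) (up b)   = up (ballot-ins p T b)
ballot-ins (suc p) (S ∷ T) (down b) = down (ballot-ins p T b)

ballot-ins⁻¹ : ∀ {d} p T → Ballot d (insPeak p T) → Ballot d T
ballot-ins⁻¹ zero    T       (up (down b)) = b
ballot-ins⁻¹ (suc p) []      (up (down b)) = b
ballot-ins⁻¹ (suc p) (E ∷ T) (up b)   = up (ballot-ins⁻¹ p T b)
ballot-ins⁻¹ (suc p) (S ∷ T) (down b) = down (ballot-ins⁻¹ p T b)

board : ℕ → List Step → List Step
board h w = replicate h E ++ w

board-E : ∀ h w → board h (E ∷ w) ≡ board (suc h) w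
board-E zero    w = refl
board-E (suc h) w = cong (E ∷_) (board-E h w)

-- The two bounds on the east steps of `T` differ only after at most `j` steps. There both hold
-- automatically, since `i` steps contain at most `i` east steps; from step `j + 1` on they
-- coincide.
under-shift : ∀ {s T} j {w} → Under s T (board (suc j) w) → Under (suc s) T (board j (S ∷ w))
under-shift zero    (same u) = rise u
under-shift zero    (fall u) = same u
under-shift (suc j) (same u) = same (under-shift j u)
under-shift (suc j) (fall u) = fall (under-shift j u)

under-shift⁻¹ : ∀ {s T} j {w} → Under (suc s) T (board j (S ∷ w)) → Under s T (board (suc j) w)
under-shift⁻¹ zero    (rise u) = same u
under-shift⁻¹ zero    (same u) = fall u
under-shift⁻¹ (suc j) (same u) = same (under-shift⁻¹ j u)
under-shift⁻¹ (suc j) (fall u) = fall (under-shift⁻¹ j u)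

-- The board gains one `E` in its initial run and the `S` after that run. If the peak lies inside
-- the run, its `S` drops the path one diagonal further below the border, and `under-shift` makes up
-- for this at the new `S`.
under-ins : ∀ {s p k} T {w} → p ≤ k → Under s T (board k w) → Under s (insPeak p T) (board (suc k) (S ∷ w))
under-ins {k = zero}  T       z≤n       u        = same (same u)
under-ins {k = suc k} T       z≤n       u        = same (fall (under-shift k u))
under-ins             (E ∷ T) (s≤s p≤k) (same u) = same (under-ins T p≤k u)
under-ins             (S ∷ T) (s≤s p≤k) (fall u) = fall (under-ins T p≤k u)

¬under-[] : ∀ {s w} k → ¬ Under s [] (board k (S ∷ w))
¬under-[] zero    ()
¬under-[] (suc k) ()

under-ins⁻¹ : ∀ {s p k} T {w} → p ≤ k → Under s (insPeak p T) (board (suc k) (S ∷ w)) → Under s T (board k w)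
under-ins⁻¹ {k = zero}  T       z≤n       (same (same u)) = u
under-ins⁻¹ {k = suc k} T       z≤n       (same (fall u)) = under-shift⁻¹ k u
-- The default clause of `insPeak` yields two letters, but this board has at least three.
under-ins⁻¹{k = suc k} []      (s≤s p≤k) (same (fall u)) = ⊥-elim (¬under-[] k u)
under-ins⁻¹             (E ∷ T) (s≤s p≤k) (same u) = same (under-ins⁻¹ T p≤k u)
under-ins⁻¹             (S ∷ T) (s≤s p≤k) (fall u) = fall (under-ins⁻¹ T p≤k u)

-- From matchings to paths

data Closing (w : List Step) (f : ℕ → ℕ) : ℕ → ℕ → Set where
  closing : ∀ {N k} → Ext N (f (suc k)) k f (delArc (f (suc k)) k f) →
            Mat N k w (delArc (f (suc k)) k f) → Closing w f (2 + N) (suc k)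

matS : ∀ {N h w f} → Mat N h (S ∷ w) f → Closing w f N h
matS {h = zero} M with Mat.size M | Mat.word M
-- With no arc open, position 0 would be a closer and hence its own partner.
... | refl | down n , _ = contradiction (n≢0⇒n>0 (Mat.nofix M z<s)) n
matS {h = suc k} {w} M with trans (Mat.size M) (cong suc (+-suc k (length w)))
... | refl = closing X (mat-ext X M)
  where X = del-ext M

-- With no letters left all positions are among the first `h`, whose partners would have to lie at
-- `h` or later, where there are none.
mat[] : ∀ {N h f} → Mat N h [] f → N ≡ 0 × h ≡ 0
mat[] {h = zero}  M = Mat.size M , refl
mat[] {h = suc h} M with trans (Mat.size M) (cong suc (+-identityʳ h))
... | refl = contradiction (Mat.bound M z<s) (≤⇒≯ (Mat.open≥ M z<s))

mat-[] : ∀ {f} → Mat 0 0 [] f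
mat-[] = record { size = refl ; bound = λ () ; invol = λ () ; nofix = λ () ; open≥ = λ () ; word = tt }

toPath : ℕ → List Step → (ℕ → ℕ) → List Step
toPath h       []      f = []
toPath h       (E ∷ w) f = toPath (suc h) w f
-- Default value: `matS` excludes a closer when no arc is open.
toPath zero    (S ∷ w) f = []
toPath (suc k) (S ∷ w) f = insPeak (f (suc k)) (toPath k w (delArc (f (suc k)) k f))

-- Functions stand for matchings only through their values below `N`; the path depends on nothing
-- else.
toPath-cong : ∀ {N h} w {f g} → Mat N h w f → (∀ {x} → x < N → f x ≡ g x) → toPath h w f ≡ toPath h w g
toPath-cong []      M eq = refl
toPath-cong (E ∷ w) M eq = toPath-cong w (matE M) eq
toPath-cong (S ∷ w) {f} {g} M eq with matS M
... | closing {N} {k} X M′ = begin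
  insPeak p (toPath k w (delArc p k f))
    ≡⟨ cong (insPeak p) (toPath-cong w M′ λ y<N →
         cong (unskip p k) (eq (skip-bound (Ext.p≤k X) (Ext.k≤N X) y<N))) ⟩
  insPeak p (toPath k w (delArc p k g))
    ≡⟨ cong (λ p → insPeak p (toPath k w (delArc p k g))) (eq (s<s (s≤s (Ext.k≤N X)))) ⟩
  toPath (suc k) (S ∷ w) g ∎
  where
  open ≡-Reasoning
  p = f (suc k)

toPath-ext : ∀ {N p k f f′} w → Ext N p k f f′ → Mat N k w f′ →
             toPath (suc k) (S ∷ w) f ≡ insPeak p (toPath k w f′)
toPath-ext {N} {p} {k} {f} {f′} w X M rewrite Ext.closer X =
  cong (insPeak p) (sym (toPath-cong w M λ {y} y<N →
    trans (sym (unskip-skip p k (f′ y))) (cong (unskip p k) (sym (Ext.rest X y<N)))))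

toPath-ballot : ∀ {N h} w {f} → Mat N h w f → Ballot 0 (toPath h w f)
toPath-ballot []      M = []
toPath-ballot (E ∷ w) M = toPath-ballot w (matE M)
toPath-ballot (S ∷ w) M with matS M
... | closing X M′ = ballot-ins _ _ (toPath-ballot w M′)

toPath-under : ∀ {N h} w {f} → Mat N h w f → Under 0 (toPath h w f) (board h w)
toPath-under []      M rewrite proj₂ (mat[] M) = []
toPath-under (E ∷ w) M = subst (Under 0 _) (sym (board-E _ w)) (toPath-under w (matE M))
toPath-under (S ∷ w) M with matS M
... | closing X M′ = under-ins _ (Ext.p≤k X) (toPath-under w M′)

toPath-length : ∀ {N h} w {f} → Mat N h w f → length (toPath h w f) ≡ N
toPath-length []      M = sym (proj₁ (mat[] M))
toPath-length (E ∷ w) M = toPath-length w (matE M)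
toPath-length (S ∷ w) {f} M with matS M
... | closing {k = k} X M′ = trans (length-insPeak (f (suc k)) (toPath k w _)) (cong (2 +_) (toPath-length w M′))

-- The bijection for an abstract choice of peak

record Rule : Set₁ where
  field
    Avoid : ℕ → (ℕ → ℕ) → Set
    -- What avoidance demands of f′ when an arc {p , k + 1} is inserted.
    Local : ℕ → ℕ → (ℕ → ℕ) → Set
    -- The peak inserted into T at p is the one that find k recovers.
    Canon : ℕ → ℕ → List Step → Set
    find  : ℕ → List Step → Maybe (ℕ × List Step)

    avoid-0 : ∀ {f} → Avoid 0 f
    avoid-ext : ∀ {N p k w f f′} → Ext N p k f f′ → Mat (2 + N) (suc k) (S ∷ w) f →
                Avoid (2 + N) f → Avoid N f′ × Local p k f′
    avoid-ext⁻¹ : ∀ {N p k w f f′} → Ext N p k f f′ → Mat (2 + N) (suc k) (S ∷ w) f →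
                  Avoid N f′ → Local p k f′ → Avoid (2 + N) f
    -- The next two fields link both sides: for an avoiding matching, the demand on its arcs amounts
    -- to canonicity of a peak inserted into its path.
    canon : ∀ {N p k w f} → Mat N k w f → Avoid N f → p ≤ k → Local p k f → Canon p k (toPath k w f)
    canon⁻¹ : ∀ {N p k w f} → Mat N k w f → Avoid N f → p ≤ k → Canon p k (toPath k w f) → Local p k f
    find-ins : ∀ {p k T} → p ≤ k → k ≤ length T → Canon p k T → find k (insPeak p T) ≡ just (p , T)
    find-just : ∀ {p T′} k T → find k T ≡ just (p , T′) → T ≡ insPeak p T′ × p ≤ k × Canon p k T′
    -- This makes the inverse total: at every closer there is a peak to delete.
    find-nothing : ∀ {T w} k → find k T ≡ nothing → Ballot 0 T → ¬ Under 0 T (board (suc k) (S ∷ w))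

module Bijection (R : Rule) where
  open Rule R

  toMatching : ℕ → List Step → List Step → ℕ → ℕ
  toMatching h       []      T = id
  toMatching h       (E ∷ w) T = toMatching (suc h) w T
  -- The value `id` here and for `nothing` below is a default; the hypotheses of `lift` exclude both
  -- cases.
  toMatching zero    (S ∷ w) T = id
  toMatching (suc k) (S ∷ w) T = maybe′ (λ { (p , T′) → insArc p k (toMatching k w T′) }) id (find k T)

  toMatching-toPath : ∀ {N h} w {f} → Mat N h w f → Avoid N f →
                      ∀ {x} → x < N → toMatching h w (toPath h w f) x ≡ f x
  toMatching-toPath [] M av x<N with proj₁ (mat[] M) | x<N
  ... | refl | ()
  toMatching-toPath (E ∷ w) M av x<N = toMatching-toPath w (matE M) av x<N
  toMatching-toPath (S ∷ w) {f} M av x<N with matS M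
  ... | closing {N} {k} X M′
    rewrite find-ins {k = k} (Ext.p≤k X) (subst (k ≤_) (sym (toPath-length w M′)) (Ext.k≤N X))
              (canon M′ (proj₁ (avoid-ext X M av)) (Ext.p≤k X) (proj₂ (avoid-ext X M av)))
    = ext-unique (ins-ext _ (Ext.p≤k X) (Ext.k≤N X)) X
        (toMatching-toPath w M′ (proj₁ (avoid-ext X M av))) x<N

  record Lift (N h : ℕ) (w T : List Step) (f : ℕ → ℕ) : Set where
    field
      mat   : Mat N h w f
      avoid : Avoid N f
      path  : toPath h w f ≡ T

  -- The three properties are proved together: `canon⁻¹` turns canonicity of the deleted peak into
  -- `Local` only for a matching already known to avoid the pattern and to have path `T′`.
  lift : ∀ h w {T} → Ballot 0 T → Under 0 T (board h w) → Ballot h w →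
         Lift (h + length w) h w T (toMatching h w T)
  lift zero [] b [] [] = record { mat = mat-[] ; avoid = avoid-0 ; path = refl }
  lift h (E ∷ w) {T} b u (up d) =
    subst (λ N → Lift N h (E ∷ w) T (toMatching h (E ∷ w) T)) (sym (+-suc h (length w)))
      record { mat = matE⁻¹ mat ; avoid = avoid ; path = path }
    where open Lift (lift (suc h) w b (subst (Under 0 _) (board-E h w) u) d)
  lift (suc k) (S ∷ w) {T} b u (down d) with find k T in eq
  ... | nothing = contradiction u (find-nothing k eq b)
  ... | just (p , T′) with find-just k T eq
  ...   | refl , p≤k , c =
    subst (λ N → Lift N (suc k) (S ∷ w) T (insArc p k f′)) (cong suc (sym (+-suc k (length w)))) record
      { mat   = M
      ; avoid = avoid-ext⁻¹ X M avoid (canon⁻¹ mat avoid p≤k (subst (Canon p k) (sym path) c))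
      ; path  = trans (toPath-ext w X mat) (cong (insPeak p) path) }
    where
    open Lift (lift k w (ballot-ins⁻¹ p T′ b) (under-ins⁻¹ T′ p≤k u) d)
    f′ = toMatching k w T′
    X : Ext (k + length w) p k (insArc p k f′) f′
    X = ins-ext f′ p≤k (m≤m+n k (length w))
    M = mat-ext⁻¹ X mat

-- The pattern 321

module _ {N p k w f f′} (X : Ext N p k f f′) (M : Mat (2 + N) (suc k) (S ∷ w) f) where
  open Ext X
  private
    module M = Mat M
    module M′ = Mat (mat-ext X M)

  ext-mono : ∀ {x y} → x < N → y < N → f′ x < f′ y → f (skip p k x) < f (skip p k y)
  ext-mono x<N y<N lt = subst₂ _<_ (sym (rest x<N)) (sym (rest y<N)) (skip-mono-< p k lt)

  ext-cancel : ∀ {x y} → x < N → y < N → f (skip p k x) < f (skip p k y) → f′ x < f′ y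
  ext-cancel x<N y<N lt = skip-cancel-< p k (subst₂ _<_ (rest x<N) (rest y<N) lt)

  -- The inserted arc closes at `k + 1`, before every other open arc.
  opener<open : ∀ {x} → x < k → f p < f (skip p k x)
  opener<open x<k = subst₂ _<_ (sym opener) (sym (rest (<-≤-trans x<k k≤N))) (skip-≥ p≤k (M′.open≥ x<k))

  -- A partner before `k + 1` would put `x` among the first `k + 1` openers, whose partners all lie
  -- beyond them. This limits the role that the new arc can play in an occurrence of a pattern.
  late : ∀ {x} → x < f x → ¬ f x < suc k
  late x<fx fx<k = <⇒≱ fx<k (M.open≥ (<-trans x<fx fx<k))

  descent : ∀ {q r} → q < r → r < k → ¬ f′ q < f′ r → f′ r < f′ q
  descent {q} {r} q<r r<k nlt =
    ≤∧≢⇒< (≮⇒≥ nlt) λ eq → <⇒≢ q<r (sym (M′.inj r<N (<-trans q<r r<N) eq))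
    where r<N = <-≤-trans r<k k≤N

Peak : ℕ → List Step → Set
Peak zero    (E ∷ S ∷ T) = ⊤
Peak (suc i) (x ∷ T)     = Peak i T
Peak _       _           = ⊥

peak-at : ∀ {p} T → p ≤ length T → Peak p (insPeak p T)
peak-at {zero}  T       le       = tt
peak-at {suc p} (x ∷ T) (s≤s le) = peak-at T le

-- The step after position `i` is now the `E` of the inserted peak.
peak-before : ∀ {i} T → suc i ≤ length T → ¬ Peak i (insPeak (suc i) T)
peak-before {zero}  (E ∷ T) le       ()
peak-before {zero}  (S ∷ T) le       ()
peak-before {suc i} (x ∷ T) (s≤s le) = peak-before T le

peak-low : ∀ {i p} T → suc i < p → p ≤ length T → Peak i (insPeak p T) ≡ Peak i T
peak-low {zero}  {suc (suc p)} (E ∷ E ∷ T) lt        le       = refl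
peak-low {zero}  {suc (suc p)} (E ∷ S ∷ T) lt        le       = refl
peak-low {zero}  {suc (suc p)} (S ∷ y ∷ T) lt        le       = refl
peak-low {zero}  {suc zero}    T           (s<s ())  le
peak-low {zero}  {suc (suc p)} (x ∷ [])    lt        (s≤s ())
peak-low {suc i} {suc p}       (x ∷ T)     (s<s lt)  (s≤s le) = peak-low T lt le

-- Position `p + 1` holds the `S` of the inserted peak, so any later peak is an old one moved by two
-- places.
peak-high : ∀ {i p} T → p ≤ i → p ≤ length T → Peak (suc i) (insPeak p T) →
            ∃ λ j → p ≤ j × suc j ≡ i × Peak j T
peak-high {zero}  {zero}  T       le        le′       ()
peak-high {suc i} {zero}  T       le        le′       pk = i , z≤n , refl , pk
peak-high {suc i} {suc p} (x ∷ T) (s≤s le) (s≤s le′) pk with peak-high T le le′ pk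
... | j , p≤j , refl , pk′ = suc j , s≤s p≤j , refl , pk′

peakHere : List Step → Maybe (ℕ × List Step)
peakHere (E ∷ S ∷ T) = just (0 , T)
peakHere _           = nothing

lastPeak : ℕ → List Step → Maybe (ℕ × List Step)
lastPeak zero    T       = peakHere T
lastPeak (suc k) []      = nothing
lastPeak (suc k) (x ∷ T) =
  -- A peak found further on takes precedence over one at the head.
  maybe′ (λ { (p , T′) → just (suc p , x ∷ T′) }) (peakHere (x ∷ T)) (lastPeak k T)

peakHere-nothing : ∀ T → ¬ Peak 0 T → peakHere T ≡ nothing
peakHere-nothing []          n = refl
peakHere-nothing (E ∷ [])    n = refl
peakHere-nothing (E ∷ E ∷ T) n = refl
peakHere-nothing (E ∷ S ∷ T) n = contradiction tt n
peakHere-nothing (S ∷ T)     n = refl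

lastPeak-nothing : ∀ k T → (∀ {i} → i ≤ k → ¬ Peak i T) → lastPeak k T ≡ nothing
lastPeak-nothing zero    T       n = peakHere-nothing T (n z≤n)
lastPeak-nothing (suc k) []      n = refl
lastPeak-nothing (suc k) (x ∷ T) n rewrite lastPeak-nothing k T (n ∘ s≤s) = peakHere-nothing (x ∷ T) (n z≤n)

peakHere-nothing⁻¹ : ∀ T → peakHere T ≡ nothing → ¬ Peak 0 T
peakHere-nothing⁻¹ (E ∷ S ∷ T) () pk

lastPeak-nothing⁻¹ : ∀ {i} k T → lastPeak k T ≡ nothing → i ≤ k → ¬ Peak i T
lastPeak-nothing⁻¹ zero (x ∷ T) eq z≤n = peakHere-nothing⁻¹ (x ∷ T) eq
lastPeak-nothing⁻¹ {suc i} (suc k) [] eq i≤k ()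
lastPeak-nothing⁻¹ (suc k) (x ∷ T) eq i≤k pk with lastPeak k T in eq′
lastPeak-nothing⁻¹ {zero}  (suc k) (x ∷ T) eq i≤k pk | nothing = peakHere-nothing⁻¹ (x ∷ T) eq pk
lastPeak-nothing⁻¹ {suc i} (suc k) (x ∷ T) eq (s≤s i≤k) pk | nothing = lastPeak-nothing⁻¹ k T eq′ i≤k pk

-- A peak of `T` at `i ≥ p` moves to `i + 2` under the insertion, so a search up to `k` would prefer
-- it exactly when `suc i < k`.
Canon321 : ℕ → ℕ → List Step → Set
Canon321 p k T = ∀ {i} → p ≤ i → suc i < k → ¬ Peak i T

lastPeak-ins : ∀ {p k T} → p ≤ k → k ≤ length T → Canon321 p k T → lastPeak k (insPeak p T) ≡ just (p , T)
lastPeak-ins {zero}  {zero}                le       le′       c = refl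
lastPeak-ins {zero}  {suc zero}            le       le′       c = refl
lastPeak-ins {zero}  {suc (suc k)} {T}     le       le′       c
  rewrite lastPeak-nothing k T (λ i≤k → c z≤n (s<s (s≤s i≤k))) = refl
lastPeak-ins {suc p} {suc k} {x ∷ T}       (s≤s le) (s≤s le′) c
  rewrite lastPeak-ins le le′ (λ {i} p≤i lt → c {suc i} (s≤s p≤i) (s<s lt)) = refl

peakHere-just : ∀ {p T′} T → peakHere T ≡ just (p , T′) → p ≡ 0 × T ≡ E ∷ S ∷ T′
peakHere-just (E ∷ S ∷ T) refl = refl , refl

lastPeak-just : ∀ {p T′} k T → lastPeak k T ≡ just (p , T′) → T ≡ insPeak p T′ × p ≤ k × Canon321 p k T′
lastPeak-just zero T eq with peakHere-just T eq
... | refl , refl = refl , z≤n , λ _ ()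
lastPeak-just (suc k) (x ∷ T) eq with lastPeak k T in eq′
lastPeak-just (suc k) (x ∷ T) refl | just (p , T′) with lastPeak-just k T eq′
... | refl , p≤k , c = refl , s≤s p≤k , λ { {suc i} (s≤s p≤i) (s<s lt) → c p≤i lt }
lastPeak-just (suc k) (x ∷ T) eq | nothing with peakHere-just (x ∷ T) eq
... | refl , refl = refl , z≤n , λ {i} _ lt → lastPeak-nothing⁻¹ k T eq′ (s≤s⁻¹ lt)

-- Without such a peak the path would begin with `k + 2` east steps, while the border has only
-- `k + 1` before its first `S`.
peak-exists : ∀ k {T w} → (∀ {i} → i ≤ k → ¬ Peak i (E ∷ T)) → ¬ Under 0 (E ∷ T) (board (suc k) (S ∷ w))
peak-exists zero    n (same (same u)) = n z≤n tt
peak-exists (suc k) n (same (same u)) = peak-exists k (n ∘ s≤s) (same u)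
peak-exists (suc k) n (same (fall u)) = n z≤n tt

lastPeak-find : ∀ {T w} k → lastPeak k T ≡ nothing → Ballot 0 T → ¬ Under 0 T (board (suc k) (S ∷ w))
lastPeak-find k eq (up b) = peak-exists k (lastPeak-nothing⁻¹ k _ eq)

-- Closers are counted from the right in the definition of containment, so 321 becomes three
-- mutually crossing arcs.
Avoid321 : ℕ → (ℕ → ℕ) → Set
Avoid321 N f = ∀ {a b c} → a < b → b < c → c < N → c < f a → f a < f b → f b < f c → ⊥

Local321 : ℕ → ℕ → (ℕ → ℕ) → Set
Local321 p k f = ∀ {q r} → p ≤ q → q < r → r < k → f r < f q

module _ {N p k w f f′} (X : Ext N p k f f′) (M : Mat (2 + N) (suc k) (S ∷ w) f) where
  open Ext X

  -- `skip` preserves occurrences. An ascent among the arcs opened after `p` would form a 3-crossing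
  -- with the new arc, which opens before them and closes first.
  avoid321-ext : Avoid321 (2 + N) f → Avoid321 N f′ × Local321 p k f′
  avoid321-ext av = av′ , local
    where
    av′ : Avoid321 N f′
    av′ a<b b<c c<N c<fa fa<fb fb<fc =
      av (skip-mono-< p k a<b) (skip-mono-< p k b<c) (skip-bound p≤k k≤N c<N)
         (subst (_ <_) (sym (rest a<N)) (skip-mono-< p k c<fa))
         (ext-mono X M a<N b<N fa<fb) (ext-mono X M b<N c<N fb<fc)
      where
      b<N = <-trans b<c c<N
      a<N = <-trans a<b b<N
    local : Local321 p k f′
    local p≤q q<r r<k = descent X M q<r r<k λ lt →
      av (skip>p p≤k p≤q) (skip-mono-< p k q<r) (skip-bound p≤k k≤N r<N)
         (subst (_ <_) (sym opener) (skip-≤ p≤k r<k))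
         (opener<open X M (<-trans q<r r<k)) (ext-mono X M (<-trans q<r r<N) r<N lt)
      where r<N = <-≤-trans r<k k≤N

  avoid321-ext⁻¹ : Avoid321 N f′ → Local321 p k f′ → Avoid321 (2 + N) f
  avoid321-ext⁻¹ av′ local a<b b<c c<N c<fa fa<fb fb<fc =
    go (view p≤k k≤N (<-trans a<b (<-trans b<c c<N))) (view p≤k k≤N (<-trans b<c c<N))
       (view p≤k k≤N c<N) a<b b<c c<fa fa<fb fb<fc
    where
    -- The new arc can only be the arc of `a`: at `b` or `c` it would force `f a < suc k`, against
    -- `late`. As the arc of `a` it needs an ascent that `local` forbids.
    go : ∀ {a b c} → View N p k a → View N p k b → View N p k c →
         a < b → b < c → c < f a → f a < f b → f b < f c → ⊥
    go isK _ _ a<b b<c c<fa _ _ =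
      <⇒≱ (<-trans a<b (<-trans b<c c<fa)) (≤-trans (≤-reflexive closer) (m≤n⇒m≤1+n p≤k))
    go _ isP _ a<b b<c c<fa fa<fb _ =
      late X M (<-trans a<b (<-trans b<c c<fa)) (subst (f _ <_) opener fa<fb)
    go _ isK _ a<b b<c c<fa fa<fb _ =
      late X M (<-trans a<b (<-trans b<c c<fa)) (<-trans (subst (f _ <_) closer fa<fb) (s≤s p≤k))
    go _ _ isP a<b b<c c<fa fa<fb fb<fc =
      late X M (<-trans a<b (<-trans b<c c<fa)) (subst (f _ <_) opener (<-trans fa<fb fb<fc))
    go _ _ isK a<b b<c c<fa fa<fb fb<fc =
      late X M (<-trans a<b (<-trans b<c c<fa)) (<-trans (subst (f _ <_) closer (<-trans fa<fb fb<fc)) (s≤s p≤k))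
    go isP (other b<N) (other c<N) a<b b<c c<fa _ fb<fc =
      <-asym (local (skip>p⁻¹ p≤k a<b) (skip-cancel-< p k b<c) (skip<k⁻¹ p≤k (subst (_ <_) opener c<fa)))
             (ext-cancel X M b<N c<N fb<fc)
    go (other a<N) (other b<N) (other c<N) a<b b<c c<fa fa<fb fb<fc =
      av′ (skip-cancel-< p k a<b) (skip-cancel-< p k b<c) c<N
          (skip-cancel-< p k (subst (_ <_) (rest a<N) c<fa))
          (ext-cancel X M a<N b<N fa<fb) (ext-cancel X M b<N c<N fb<fc)

module _ {N p k w f f′} (X : Ext N p k f f′) (M : Mat (2 + N) (suc k) (S ∷ w) f)
         (local : Local321 p k f′) (T : List Step) (|T| : length T ≡ N)
         (ih : ∀ {i} → suc i < k → f′ i < f′ (suc i) ⇔ Peak i T) where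
  open Ext X
  private
    p≤T : p ≤ length T
    p≤T = subst (p ≤_) (sym |T|) (≤-trans p≤k k≤N)

  -- The new arc closes first, giving a descent at `p - 1` and an ascent at `p`; likewise the new
  -- peak rules out a peak at `p - 1` and creates one at `p`. Further left nothing changes. Further
  -- right `local` leaves no ascents, hence by `ih` no peaks.
  ascent⇔peak-ext : ∀ {i} → suc i < suc k → f i < f (suc i) ⇔ Peak i (insPeak p T)
  ascent⇔peak-ext {i} i<k with <-cmp (suc i) p
  ... | tri< i<p _ _ = mk⇔
    (λ asc → subst id (sym low) (to (ext-cancel X M i<N i′<N (subst₂ _<_ (sym eq) (sym eq′) asc))))
    (λ pk → subst₂ _<_ eq eq′ (ext-mono X M i<N i′<N (from (subst id low pk))))
    where
    i′<N = <-≤-trans i<p (≤-trans p≤k k≤N)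
    i<N  = <-trans (n<1+n i) i′<N
    eq   = cong f (skip-low p≤k (<-trans (n<1+n i) i<p))
    eq′  = cong f (skip-low p≤k i<p)
    low  = peak-low T i<p p≤T
    open Equivalence (ih (<-≤-trans i<p p≤k))
  ... | tri≈ _ refl _ = mk⇔
    (λ asc → contradiction
       (subst (_< f (suc i)) (cong f (sym (skip-low p≤k ≤-refl))) asc) (<-asym (opener<open X M p≤k)))
    (λ pk → contradiction pk (peak-before T p≤T))
  ... | tri> _ _ p≤i with m≤n⇒m<n∨m≡n (s≤s⁻¹ p≤i)
  ...   | inj₂ refl = mk⇔
    (λ _ → peak-at T p≤T)
    (λ _ → subst (f p <_) (cong f (skip-mid p≤k ≤-refl (s<s⁻¹ i<k))) (opener<open X M (s<s⁻¹ i<k)))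
  ascent⇔peak-ext {suc i} i<k | tri> _ _ _ | inj₁ (s≤s p≤i) = mk⇔
    (λ asc → contradiction
       (ext-cancel X M (<-trans (n<1+n i) i′<N) i′<N
         (subst₂ _<_ (cong f (sym (skip-mid p≤k p≤i (<-trans (n<1+n i) i′<k))))
                     (cong f (sym (skip-mid p≤k (m≤n⇒m≤1+n p≤i) i′<k))) asc))
       (<-asym (local p≤i ≤-refl i′<k)))
    (λ pk → ⊥-elim (noPeak (peak-high T p≤i p≤T pk)))
    where
    i′<k = s<s⁻¹ i<k
    i′<N = <-≤-trans i′<k k≤N
    noPeak : ¬ ∃ λ j → p ≤ j × suc j ≡ i × Peak j T
    noPeak (j , p≤j , refl , pk) = <-asym (local p≤j ≤-refl j<k) (Equivalence.from (ih j<k) pk)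
      where j<k = <-trans (n<1+n (suc j)) i′<k

-- The dictionary for 321: it turns the demand on the arcs opened after `p` into the absence of
-- peaks.
ascent⇔peak : ∀ {N h} w {f i} → Mat N h w f → Avoid321 N f → suc i < h →
              f i < f (suc i) ⇔ Peak i (toPath h w f)
ascent⇔peak [] M av i<h with proj₂ (mat[] M) | i<h
... | refl | ()
ascent⇔peak (E ∷ w) M av i<h = ascent⇔peak w (matE M) av (m<n⇒m<1+n i<h)
ascent⇔peak (S ∷ w) {f} M av i<h with matS M
... | closing {N} {k} X M′ =
  ascent⇔peak-ext X M (proj₂ (avoid321-ext X M av)) (toPath k w _) (toPath-length w M′)
    (ascent⇔peak w M′ (proj₁ (avoid321-ext X M av))) i<h

descending : ∀ {p k f} → (∀ {i} → p ≤ i → suc i < k → f (suc i) < f i) → Local321 p k f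
descending d {r = suc r} p≤q q<r r<k with m≤n⇒m<n∨m≡n (s≤s⁻¹ q<r)
... | inj₂ refl = d p≤q r<k
... | inj₁ q<r′ = <-trans (d (≤-trans p≤q (<⇒≤ q<r′)) r<k)
                          (descending d p≤q q<r′ (<-trans (n<1+n r) r<k))

canon321 : ∀ {N p k w f} → Mat N k w f → Avoid321 N f → p ≤ k → Local321 p k f → Canon321 p k (toPath k w f)
canon321 {w = w} M av p≤k local p≤i lt pk =
  <-asym (local p≤i ≤-refl lt) (Equivalence.from (ascent⇔peak w M av lt) pk)

canon321⁻¹ : ∀ {N p k w f} → Mat N k w f → Avoid321 N f → p ≤ k → Canon321 p k (toPath k w f) → Local321 p k f
canon321⁻¹ {w = w} M av p≤k c = descending λ {i} p≤i i<k →
  let i<N = <-≤-trans i<k (Mat.h≤N M) in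
  ≤∧≢⇒< (≮⇒≥ λ asc → c p≤i i<k (Equivalence.to (ascent⇔peak w M av i<k) asc))
    λ eq → <⇒≢ (n<1+n i) (sym (Mat.inj M i<N (<-trans (n<1+n i) i<N) eq))

rule321 : Rule
rule321 = record
  { Avoid = Avoid321 ; Local = Local321 ; Canon = Canon321 ; find = lastPeak
  ; avoid-0 = λ _ _ () ; avoid-ext = avoid321-ext ; avoid-ext⁻¹ = avoid321-ext⁻¹
  ; canon = canon321 ; canon⁻¹ = λ {w = w} → canon321⁻¹ {w = w}
  ; find-ins = lastPeak-ins ; find-just = lastPeak-just ; find-nothing = lastPeak-find }

-- The pattern 213

-- A nonempty Dyck path starts with `E`, and its first peak ends the initial run of `E`; the search
-- only climbs this run.
firstPeak : ℕ → List Step → Maybe (ℕ × List Step)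
firstPeak k       (E ∷ S ∷ T) = just (0 , T)
firstPeak (suc k) (E ∷ E ∷ T) = Maybe.map (Product.map suc (E ∷_)) (firstPeak k (E ∷ T))
firstPeak _       _           = nothing

Ups : ℕ → List Step → Set
Ups zero    T       = ⊤
Ups (suc j) (E ∷ T) = Ups j T
Ups (suc j) _       = ⊥

-- In a Dyck path the peak inserted at `p` is the first one exactly when only east steps precede it.
Canon213 : ℕ → ℕ → List Step → Set
Canon213 p k T = Ups p T

firstPeak-ins : ∀ {p k T} → p ≤ k → k ≤ length T → Canon213 p k T → firstPeak k (insPeak p T) ≡ just (p , T)
firstPeak-ins le le′ c = go le c
  where
  go : ∀ {p k T} → p ≤ k → Ups p T → firstPeak k (insPeak p T) ≡ just (p , T)
  go {zero}        {k}     {T}         le       c = refl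
  go {suc zero}    {suc k} {E ∷ T}     (s≤s le) c = refl
  go {suc (suc p)} {suc k} {E ∷ E ∷ T} (s≤s le) c rewrite go {suc p} {k} {E ∷ T} le c = refl

firstPeak-just : ∀ {p T′} k T → firstPeak k T ≡ just (p , T′) → T ≡ insPeak p T′ × p ≤ k × Canon213 p k T′
firstPeak-just zero    (E ∷ S ∷ T) refl = refl , z≤n , tt
firstPeak-just (suc k) (E ∷ S ∷ T) refl = refl , z≤n , tt
firstPeak-just (suc k) (E ∷ E ∷ T) eq with firstPeak k (E ∷ T) in eq′
firstPeak-just (suc k) (E ∷ E ∷ T) refl | just (p , T′) with firstPeak-just k (E ∷ T) eq′
... | eq″ , p≤k , c = cong (E ∷_) eq″ , s≤s p≤k , c

firstPeak-find : ∀ {T w} k → firstPeak k T ≡ nothing → Ballot 0 T → ¬ Under 0 T (board (suc k) (S ∷ w))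
firstPeak-find k eq (up b) = go k _ eq
  where
  go : ∀ k T {w} → firstPeak k (E ∷ T) ≡ nothing → ¬ Under 0 (E ∷ T) (board (suc k) (S ∷ w))
  go zero    (S ∷ T) () u
  go (suc k) (S ∷ T) () u
  go zero    []      eq (same ())
  go (suc k) []      eq (same ())
  go zero    (E ∷ T) eq (same ())
  go (suc k) (E ∷ T) eq (same (same u)) with firstPeak k (E ∷ T) in eq′
  ... | nothing = go k T eq′ (same u)

ups-low : ∀ {j p} T → j ≤ p → p ≤ length T → Ups j (insPeak p T) ≡ Ups j T
ups-low {zero}          T       le       le′       = refl
ups-low {suc j} {suc p} (E ∷ T) (s≤s le) (s≤s le′) = ups-low T le le′
ups-low {suc j} {suc p} (S ∷ T) (s≤s le) (s≤s le′) = refl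

ups-at : ∀ p T → Ups p T → Ups (suc p) (insPeak p T)
ups-at zero    T       c = tt
ups-at (suc p) (E ∷ T) c = ups-at p T c

ups-high : ∀ {j p} T → suc p < j → p ≤ length T → ¬ Ups j (insPeak p T)
ups-high {suc (suc j)} {zero}  T       lt       le       ()
ups-high {suc j}       {suc p} (E ∷ T) (s<s lt) (s≤s le) c = ups-high T lt le c

-- An occurrence consists of two crossing arcs with a third one, opened last and closed first,
-- nested below both.
Avoid213 : ℕ → (ℕ → ℕ) → Set
Avoid213 N f = ∀ {a b c} → a < b → b < c → c < N → c < f c → f c < f a → f a < f b → ⊥

Descends : ℕ → (ℕ → ℕ) → Set
Descends j f = ∀ {q r} → q < r → r < j → f r < f q

Local213 : ℕ → ℕ → (ℕ → ℕ) → Set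
Local213 p k f = Descends p f

module _ {N p k w f f′} (X : Ext N p k f f′) (M : Mat (2 + N) (suc k) (S ∷ w) f) where
  open Ext X

  -- An ascent among the arcs opened before `p` would be a crossing with the new arc nested below
  -- it.
  avoid213-ext : Avoid213 (2 + N) f → Avoid213 N f′ × Local213 p k f′
  avoid213-ext av = av′ , local
    where
    av′ : Avoid213 N f′
    av′ a<b b<c c<N c<fc fc<fa fa<fb =
      av (skip-mono-< p k a<b) (skip-mono-< p k b<c) (skip-bound p≤k k≤N c<N)
         (subst (_ <_) (sym (rest c<N)) (skip-mono-< p k c<fc))
         (ext-mono X M c<N a<N fc<fa) (ext-mono X M a<N b<N fa<fb)
      where
      b<N = <-trans b<c c<N
      a<N = <-trans a<b b<N
    local : Local213 p k f′
    local {q} {r} q<r r<p = descent X M q<r r<k λ lt →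
      av (skip-mono-< p k q<r) (subst (_< p) (sym (skip-low p≤k r<p)) r<p)
         (≤-trans (s≤s (≤-trans p≤k k≤N)) (n≤1+n _))
         (subst (p <_) (sym opener) (s≤s p≤k))
         (opener<open X M (<-trans q<r r<k))
         (ext-mono X M (<-trans q<r r<N) r<N lt)
      where
      r<k = <-≤-trans r<p p≤k
      r<N = <-≤-trans r<k k≤N

  avoid213-ext⁻¹ : Avoid213 N f′ → Local213 p k f′ → Avoid213 (2 + N) f
  avoid213-ext⁻¹ av′ local a<b b<c c<N c<fc fc<fa fa<fb =
    go (view p≤k k≤N (<-trans a<b (<-trans b<c c<N))) (view p≤k k≤N (<-trans b<c c<N))
       (view p≤k k≤N c<N) a<b b<c c<fc fc<fa fa<fb
    where
    -- Closing first, the new arc can only be the innermost arc, that of `c`: at `a` or `b` it would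
    -- force `f c < suc k`. At `c` it needs an ascent before `p`, which `local` forbids.
    go : ∀ {a b c} → View N p k a → View N p k b → View N p k c →
         a < b → b < c → c < f c → f c < f a → f a < f b → ⊥
    go isP _ _ a<b b<c c<fc fc<fa fa<fb = late X M c<fc (subst (f _ <_) opener fc<fa)
    go isK _ _ a<b b<c c<fc fc<fa fa<fb =
      late X M c<fc (<-trans (subst (f _ <_) closer fc<fa) (s≤s p≤k))
    go _ isP _ a<b b<c c<fc fc<fa fa<fb =
      late X M c<fc (<-trans fc<fa (subst (f _ <_) opener fa<fb))
    go _ isK _ a<b b<c c<fc fc<fa fa<fb =
      late X M c<fc (<-trans fc<fa (<-trans (subst (f _ <_) closer fa<fb) (s≤s p≤k)))
    go _ _ isK a<b b<c c<fc fc<fa fa<fb =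
      late X M c<fc (subst (_< suc k) (sym closer) (s≤s p≤k))
    go {a} {b} (other a<N) (other b<N) isP a<b b<c c<fc fc<fa fa<fb =
      <-asym (local (skip-cancel-< p k a<b) (≰⇒> λ p≤b → <-asym b<c (skip>p p≤k p≤b)))
             (ext-cancel X M a<N b<N fa<fb)
    go (other a<N) (other b<N) (other c<N) a<b b<c c<fc fc<fa fa<fb =
      av′ (skip-cancel-< p k a<b) (skip-cancel-< p k b<c) c<N
          (skip-cancel-< p k (subst (_ <_) (rest c<N) c<fc))
          (ext-cancel X M c<N a<N fc<fa) (ext-cancel X M a<N b<N fa<fb)

module _ {N p k w f f′} (X : Ext N p k f f′) (M : Mat (2 + N) (suc k) (S ∷ w) f)
         (local : Local213 p k f′) (T : List Step) (|T| : length T ≡ N)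
         (ih : ∀ {j} → j ≤ k → Descends j f′ ⇔ Ups j T) where
  open Ext X
  private
    p≤T : p ≤ length T
    p≤T = subst (p ≤_) (sym |T|) (≤-trans p≤k k≤N)

  -- Up to `p` nothing changes. For `j ≡ p + 1` both sides hold, as the new arc closes first and the
  -- new `E` prolongs the run. For larger `j` both fail: `f` ascends from `p` to `p + 1`, and the
  -- path has `S` at `p + 1`.
  descends⇔ups-ext : ∀ {j} → j ≤ suc k → Descends j f ⇔ Ups j (insPeak p T)
  descends⇔ups-ext {j} j≤k with ≤-<-connex j p
  ... | inj₁ j≤p = mk⇔
    (λ d → subst id (sym low) (to λ q<r r<j →
      ext-cancel X M (<-≤-trans r<j j≤N) (<-trans q<r (<-≤-trans r<j j≤N))
        (subst₂ _<_ (fixed r<j) (fixed (<-trans q<r r<j)) (d q<r r<j))))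
    (λ u {q} {r} q<r r<j → subst₂ _<_ (sym (fixed r<j)) (sym (fixed (<-trans q<r r<j)))
      (ext-mono X M (<-≤-trans r<j j≤N) (<-trans q<r (<-≤-trans r<j j≤N))
        (from (subst id low u) q<r r<j)))
    where
    j≤N = ≤-trans j≤p (≤-trans p≤k k≤N)
    low = ups-low T j≤p p≤T
    open Equivalence (ih (≤-trans j≤p p≤k))
    fixed : ∀ {x} → x < j → f x ≡ f (skip p k x)
    fixed x<j = cong f (sym (skip-low p≤k (<-≤-trans x<j j≤p)))
  ... | inj₂ p<j with m≤n⇒m<n∨m≡n p<j
  ...   | inj₂ refl = mk⇔
    (λ _ → ups-at p T (Equivalence.to (ih p≤k) local))
    (λ _ {q} {r} q<r r≤p → desc q<r (m≤n⇒m<n∨m≡n (s≤s⁻¹ r≤p)))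
    where
    desc : ∀ {q r} → q < r → r < p ⊎ r ≡ p → f r < f q
    desc q<r (inj₁ r<p) = subst₂ _<_ (cong f (skip-low p≤k r<p)) (cong f (skip-low p≤k (<-trans q<r r<p)))
      (ext-mono X M r<N (<-trans q<r r<N) (local q<r r<p))
      where r<N = <-≤-trans r<p (≤-trans p≤k k≤N)
    desc q<p (inj₂ refl) = subst (f p <_) (cong f (skip-low p≤k q<p)) (opener<open X M (<-≤-trans q<p p≤k))
  ...   | inj₁ 1+p<j = mk⇔
    (λ d → contradiction (subst (f (suc p) <_) opener (d (n<1+n p) 1+p<j))
             (≤⇒≯ (Mat.open≥ M (<-≤-trans 1+p<j j≤k))))
    (λ u → ⊥-elim (ups-high T 1+p<j p≤T u))

descends⇔ups : ∀ {N h} w {f j} → Mat N h w f → Avoid213 N f → j ≤ h → Descends j f ⇔ Ups j (toPath h w f)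
descends⇔ups [] M av j≤h with proj₂ (mat[] M) | j≤h
... | refl | z≤n = mk⇔ (λ _ → tt) (λ _ {_} {_} _ ())
descends⇔ups (E ∷ w) M av j≤h = descends⇔ups w (matE M) av (m≤n⇒m≤1+n j≤h)
descends⇔ups (S ∷ w) {f} M av j≤h with matS M
... | closing {N} {k} X M′ =
  descends⇔ups-ext X M (proj₂ (avoid213-ext X M av)) (toPath k w _) (toPath-length w M′)
    (descends⇔ups w M′ (proj₁ (avoid213-ext X M av))) j≤h

rule213 : Rule
rule213 = record
  { Avoid = Avoid213 ; Local = Local213 ; Canon = Canon213 ; find = firstPeak
  ; avoid-0 = λ _ _ () ; avoid-ext = avoid213-ext ; avoid-ext⁻¹ = avoid213-ext⁻¹
  ; canon   = λ {w = w} M av p≤k → Equivalence.to (descends⇔ups w M av p≤k)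
  ; canon⁻¹ = λ {w = w} M av p≤k → Equivalence.from (descends⇔ups w M av p≤k)
  ; find-ins = firstPeak-ins ; find-just = firstPeak-just ; find-nothing = firstPeak-find }

-- From functions and words to matchings and Dyck paths

easts+souths : ∀ T → easts T + souths T ≡ length T
easts+souths []      = refl
easts+souths (E ∷ T) = cong suc (easts+souths T)
easts+souths (S ∷ T) = trans (+-suc (easts T) (souths T)) (cong suc (easts+souths T))

ballot : ∀ {d} T → (∀ k → souths (take k T) ≤ d + easts (take k T)) → d + easts T ≡ souths T → Ballot d T
ballot {d} [] p eq rewrite +-identityʳ d | eq = []
ballot {d} (E ∷ T) p eq =
  up (ballot T (λ k → ≤-trans (p (suc k)) (≤-reflexive (+-suc d _))) (trans (sym (+-suc d _)) eq))
ballot {zero}  (S ∷ T) p eq = contradiction (p 1) λ ()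
ballot {suc d} (S ∷ T) p eq = down (ballot T (s≤s⁻¹ ∘ p ∘ suc) (suc-injective eq))

ballot-prefix : ∀ {d T} → Ballot d T → ∀ k → souths (take k T) ≤ d + easts (take k T)
ballot-prefix b            zero    = z≤n
ballot-prefix []           (suc k) = z≤n
ballot-prefix {d} (up b)   (suc k) = ≤-trans (ballot-prefix b k) (≤-reflexive (sym (+-suc d _)))
ballot-prefix (down b)     (suc k) = s≤s (ballot-prefix b k)

ballot-total : ∀ {d T} → Ballot d T → d + easts T ≡ souths T
ballot-total []           = refl
ballot-total {d} (up b)   = trans (+-suc d _) (ballot-total b)
ballot-total (down b)     = cong suc (ballot-total b)

dyck⇒ballot : ∀ {n T} → IsDyck n T → Ballot 0 T
dyck⇒ballot {n} {T} (len , east , prefix) = ballot T prefix (trans east (sym south))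
  where
  south : souths T ≡ n
  south = +-cancelˡ-≡ n _ _ (trans (cong (_+ souths T) (sym east)) (trans (easts+souths T) len))

-- East and south steps are equally many, so the length fixes their number.
ballot⇒dyck : ∀ {n T} → length T ≡ n + n → Ballot 0 T → IsDyck n T
ballot⇒dyck {n} {T} len b = len , double-injective (trans total len) , ballot-prefix b
  where
  total : easts T + easts T ≡ length T
  total = trans (cong (easts T +_) (ballot-total b)) (easts+souths T)
  double-injective : ∀ {m n} → m + m ≡ n + n → m ≡ n
  double-injective {m} {n} eq with <-cmp m n
  ... | tri< m<n _ _ = contradiction eq (<⇒≢ (+-mono-< m<n m<n))
  ... | tri≈ _ m≡n _ = m≡n
  ... | tri> _ _ n<m = contradiction (sym eq) (<⇒≢ (+-mono-< n<m n<m))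

under : ∀ {s} D F → length D ≡ length F → (∀ k → easts (take k D) ≤ s + easts (take k F)) → Under s D F
under []      []      eq p = []
under (E ∷ D) (E ∷ F) eq p = same (under D F (suc-injective eq) λ k → s≤s⁻¹ (≤-trans (p (suc k)) (≤-reflexive (+-suc _ _))))
under (S ∷ D) (S ∷ F) eq p = same (under D F (suc-injective eq) (p ∘ suc))
under (S ∷ D) (E ∷ F) eq p = fall (under D F (suc-injective eq) λ k → ≤-trans (p (suc k)) (≤-reflexive (+-suc _ _)))
under {zero}  (E ∷ D) (S ∷ F) eq p = contradiction (p 1) λ ()
under {suc s} (E ∷ D) (S ∷ F) eq p = rise (under D F (suc-injective eq) (s≤s⁻¹ ∘ p ∘ suc))

under-prefix : ∀ {s D F} → Under s D F → ∀ k → easts (take k D) ≤ s + easts (take k F)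
under-prefix u                  zero    = z≤n
under-prefix []                 (suc k) = z≤n
under-prefix (same {x = E} u)   (suc k) = ≤-trans (s≤s (under-prefix u k)) (≤-reflexive (sym (+-suc _ _)))
under-prefix (same {x = S} u)   (suc k) = under-prefix u k
under-prefix (fall u)           (suc k) = ≤-trans (under-prefix u k) (≤-reflexive (sym (+-suc _ _)))
under-prefix (rise u)           (suc k) = s≤s (under-prefix u k)

under-length : ∀ {s D F} → Under s D F → length D ≡ length F
under-length []       = refl
under-length (same u) = cong suc (under-length u)
under-length (fall u) = cong suc (under-length u)
under-length (rise u) = cong suc (under-length u)

-- A relation rather than a function, because many functions represent the same vector; they agree
-- only below `N`.
record Rep {N} (m : Vec (Fin N) N) (f : ℕ → ℕ) : Set where
  constructor rep
  field at : ∀ i → f (toℕ i) ≡ toℕ (lookup m i)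

toFun : ∀ {N} → Vec (Fin N) N → ℕ → ℕ
toFun {N} m x with x <? N
... | yes x<N = toℕ (lookup m (fromℕ< x<N))
... | no _    = x

toFun-rep : ∀ {N} (m : Vec (Fin N) N) → Rep m (toFun m)
toFun-rep {N} m = rep at
  where
  at : ∀ i → toFun m (toℕ i) ≡ toℕ (lookup m i)
  at i with toℕ i <? N
  ... | yes lt = cong (toℕ ∘ lookup m) (Fin.fromℕ<-toℕ i lt)
  ... | no nlt = contradiction (Fin.toℕ<n i) nlt

clip : ∀ {N} → ℕ → Fin N → Fin N
clip {N} y i with y <? N
... | yes y<N = fromℕ< y<N
-- Default outside the range, never reached when `f` is bounded by `N`.
... | no _    = i

clip-toℕ : ∀ {N} {y} {i : Fin N} → y < N → toℕ (clip y i) ≡ y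
clip-toℕ {N} {y} y<N with y <? N
... | yes lt = Fin.toℕ-fromℕ< lt
... | no nlt = contradiction y<N nlt

toVec : ∀ {N} → (ℕ → ℕ) → Vec (Fin N) N
toVec f = tabulate λ i → clip (f (toℕ i)) i

toVec-rep : ∀ {N f} → (∀ {x} → x < N → f x < N) → Rep {N} (toVec f) f
toVec-rep bound = rep λ i →
  sym (trans (cong toℕ (lookup∘tabulate _ i)) (clip-toℕ (bound (Fin.toℕ<n i))))

rep-toVec : ∀ {N f} {m : Vec (Fin N) N} → Rep m f → toVec f ≡ m
rep-toVec {m = m} (rep r) = trans (tabulate-cong λ i → Fin.toℕ-injective
  (trans (clip-toℕ (subst (_< _) (sym (r i)) (Fin.toℕ<n _))) (r i))) (tabulate∘lookup m)

rep-unique : ∀ {N f g} {m : Vec (Fin N) N} → Rep m f → Rep m g → ∀ {x} → x < N → f x ≡ g x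
rep-unique {f = f} {g} (rep r) (rep r′) x<N =
  subst (λ x → f x ≡ g x) (Fin.toℕ-fromℕ< x<N) (trans (r _) (sym (r′ _)))

point : ∀ {N x} → x < N → ∃ λ (i : Fin N) → toℕ i ≡ x
point x<N = fromℕ< x<N , Fin.toℕ-fromℕ< x<N

dir-unique : ∀ {f x s t} → Dir f x s → Dir f x t → s ≡ t
dir-unique (up _)   (up _)   = refl
dir-unique (up l)   (down n) = contradiction l n
dir-unique (down n) (up l)   = contradiction l n
dir-unique (down _) (down _) = refl

module _ {f : ℕ → ℕ} where

  word-tabulate : ∀ n x (g : Fin n → Step) → (∀ i → Dir f (x + toℕ i) (g i)) → Word f x (toList (tabulate g))
  word-tabulate zero    x g d = tt
  word-tabulate (suc n) x g d =
    subst (λ y → Dir f y (g Fin.zero)) (+-identityʳ x) (d Fin.zero) ,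
    word-tabulate n (suc x) (g ∘ Fin.suc) λ i → subst (λ y → Dir f y (g (Fin.suc i))) (+-suc x _) (d (Fin.suc i))

  tabulate-word : ∀ n x (g : Fin n → Step) w → n ≡ length w → (∀ i → Dir f (x + toℕ i) (g i)) →
                  Word f x w → toList (tabulate g) ≡ w
  tabulate-word zero    x g []      eq d ws = refl
  tabulate-word (suc n) x g (s ∷ w) eq d (d₀ , ws) = cong₂ _∷_
    (dir-unique (subst (λ y → Dir f y (g Fin.zero)) (+-identityʳ x) (d Fin.zero)) d₀)
    (tabulate-word n (suc x) (g ∘ Fin.suc) w (suc-injective eq)
      (λ i → subst (λ y → Dir f y (g (Fin.suc i))) (+-suc x _) (d (Fin.suc i))) ws)

length-shapeWord : ∀ {N} (m : Vec (Fin N) N) → length (shapeWord m) ≡ N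
length-shapeWord m = go (tabulate _)
  where
  go : ∀ {n} (v : Vec Step n) → length (toList v) ≡ n
  go Vec.[]      = refl
  go (x Vec.∷ v) = cong suc (go v)

module _ {N f} {m : Vec (Fin N) N} (R : Rep m f) where
  private r = Rep.at R

  shape-dir : ∀ i → Dir f (toℕ i) (if does (i Fin.<? lookup m i) then E else S)
  shape-dir i = go (i Fin.<? lookup m i)
    where
    go : (d : Dec (i Fin.< lookup m i)) → Dir f (toℕ i) (if does d then E else S)
    go (yes lt) = up (subst (toℕ i <_) (sym (r i)) lt)
    go (no nlt) = down (nlt ∘ subst (toℕ i <_) (r i))

  rep-mat : ∀ {w} → IsPerfectMatching m → shapeWord m ≡ w → Mat N 0 w f
  rep-mat (inv , nofix) refl = record
    { size  = sym (length-shapeWord m)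
    ; bound = λ x<N → bound (point x<N)
    ; invol = λ x<N → invol (point x<N)
    ; nofix = λ x<N → nofix′ (point x<N)
    ; open≥ = λ ()
    ; word  = word-tabulate N 0 _ shape-dir }
    where
    bound : ∀ {x} → ∃ (λ (i : Fin N) → toℕ i ≡ x) → f x < N
    bound (i , refl) = subst (_< N) (sym (r i)) (Fin.toℕ<n _)
    invol : ∀ {x} → ∃ (λ (i : Fin N) → toℕ i ≡ x) → f (f x) ≡ x
    invol (i , refl) rewrite r i | r (lookup m i) = cong toℕ (inv i)
    nofix′ : ∀ {x} → ∃ (λ (i : Fin N) → toℕ i ≡ x) → f x ≢ x
    nofix′ (i , refl) eq = nofix i (Fin.toℕ-injective (trans (sym (r i)) eq))

  mat-rep : ∀ {w} → Mat N 0 w f → IsPerfectMatching m × shapeWord m ≡ w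
  mat-rep {w} M = (inv , nofix′) , tabulate-word N 0 _ w size shape-dir word
    where
    open Mat M
    inv : ∀ i → lookup m (lookup m i) ≡ i
    inv i = Fin.toℕ-injective (trans (sym (r (lookup m i)))
              (trans (cong f (sym (r i))) (invol (Fin.toℕ<n i))))
    nofix′ : ∀ i → lookup m i ≢ i
    nofix′ i eq = nofix (Fin.toℕ<n i) (trans (r i) (cong toℕ eq))

  avoids321 : Avoids m τ321 ⇔ Avoid321 N f
  avoids321 = mk⇔ to from
    where
    to : Avoids m τ321 → Avoid321 N f
    to av a<b b<c c<N c<fa fa<fb fb<fc
      with point (<-trans a<b (<-trans b<c c<N)) | point (<-trans b<c c<N) | point c<N
    ... | i , refl | j , refl | k , refl = av (lookup v , (λ _ _ → lookup⁺ Fin.<-trans increasing) ,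
        λ { Fin.zero → refl ; (Fin.suc Fin.zero) → refl ; (Fin.suc (Fin.suc Fin.zero)) → refl })
      where
      v = i Vec.∷ j Vec.∷ k Vec.∷ lookup m i Vec.∷ lookup m j Vec.∷ lookup m k Vec.∷ Vec.[]
      increasing : Linked Fin._<_ v
      increasing = a<b ∷ b<c ∷ subst (_ <_) (r i) c<fa ∷ subst₂ _<_ (r i) (r j) fa<fb
                 ∷ subst₂ _<_ (r j) (r k) fb<fc ∷ [-]
    from : Avoid321 N f → Avoids m τ321
    from av (g , mono , arcs) = av (mono (# 0) (# 1) (s≤s z≤n)) (mono (# 1) (# 2) (s≤s (s≤s z≤n)))
      (Fin.toℕ<n _)
      (subst (_ <_) (arc (# 0)) (mono (# 2) (# 3) ≤-refl))
      (subst₂ _<_ (arc (# 0)) (arc (# 1)) (mono (# 3) (# 4) ≤-refl))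
      (subst₂ _<_ (arc (# 1)) (arc (# 2)) (mono (# 4) (# 5) ≤-refl))
      where
      arc : ∀ a → toℕ (g (opposite (τ321 a ↑ˡ 3))) ≡ f (toℕ (g (a ↑ˡ 3)))
      arc a = sym (trans (r _) (cong toℕ (arcs a)))

  avoids213 : Avoids m τ213 ⇔ Avoid213 N f
  avoids213 = mk⇔ to from
    where
    to : Avoids m τ213 → Avoid213 N f
    to av a<b b<c c<N c<fc fc<fa fa<fb
      with point (<-trans a<b (<-trans b<c c<N)) | point (<-trans b<c c<N) | point c<N
    ... | i , refl | j , refl | k , refl = av (lookup v , (λ _ _ → lookup⁺ Fin.<-trans increasing) ,
        λ { Fin.zero → refl ; (Fin.suc Fin.zero) → refl ; (Fin.suc (Fin.suc Fin.zero)) → refl })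
      where
      -- Read through `opposite`, 213 puts the closer of the third arc first, followed by those of
      -- the first and the second.
      v = i Vec.∷ j Vec.∷ k Vec.∷ lookup m k Vec.∷ lookup m i Vec.∷ lookup m j Vec.∷ Vec.[]
      increasing : Linked Fin._<_ v
      increasing = a<b ∷ b<c ∷ subst (_ <_) (r k) c<fc ∷ subst₂ _<_ (r k) (r i) fc<fa
                 ∷ subst₂ _<_ (r i) (r j) fa<fb ∷ [-]
    from : Avoid213 N f → Avoids m τ213
    from av (g , mono , arcs) = av (mono (# 0) (# 1) (s≤s z≤n)) (mono (# 1) (# 2) (s≤s (s≤s z≤n)))
      (Fin.toℕ<n _)
      (subst (_ <_) (arc (# 2)) (mono (# 2) (# 3) ≤-refl))
      (subst₂ _<_ (arc (# 2)) (arc (# 0)) (mono (# 3) (# 4) ≤-refl))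
      (subst₂ _<_ (arc (# 0)) (arc (# 1)) (mono (# 4) (# 5) ≤-refl))
      where
      arc : ∀ a → toℕ (g (opposite (τ213 a ↑ˡ 3))) ≡ f (toℕ (g (a ↑ˡ 3)))
      arc a = sym (trans (r _) (cong toℕ (arcs a)))

-- The bijections between `ℳ` and `D²`

infix 4 _≟-step_
_≟-step_ : DecidableEquality Step
E ≟-step E = yes refl
E ≟-step S = no λ ()
S ≟-step E = no λ ()
S ≟-step S = yes refl

module _ (R : Rule) {τ : Fin 3 → Fin 3}
         (avoids : ∀ {N f} {m : Vec (Fin N) N} → Rep m f → Avoids m τ ⇔ Rule.Avoid R N f)
         (n : ℕ) where
  open Bijection R

  IsMatching : List Step → Vec (Fin (n + n)) (n + n) → Set
  IsMatching w m = IsPerfectMatching m × (shapeWord m ≡ w) × Avoids m τ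

  path : List Step → Vec (Fin (n + n)) (n + n) → List Step
  path w m = toPath 0 w (toFun m)

  matching : List Step → List Step → Vec (Fin (n + n)) (n + n)
  matching w T = toVec (toMatching 0 w T)

  path-dyck : ∀ w m → IsMatching w m → IsDyck n (path w m)
  path-dyck w m (pm , sh , av) = ballot⇒dyck (toPath-length w M) (toPath-ballot w M)
    where M = rep-mat (toFun-rep m) pm sh

  path-under : ∀ w m → IsMatching w m → NotAbove (path w m) w
  path-under w m (pm , sh , av) = under-prefix (toPath-under w (rep-mat (toFun-rep m) pm sh))

  matching-path : ∀ w m → IsMatching w m → matching w (path w m) ≡ m
  matching-path w m (pm , sh , av) = rep-toVec {f = toMatching 0 w (path w m)} (rep λ i →
    trans (toMatching-toPath w (rep-mat r pm sh) (Equivalence.to (avoids r) av) (Fin.toℕ<n i)) (Rep.at r i))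
    where r = toFun-rep m

  module _ w T (dw : IsDyck n w) (dT : IsDyck n T) (na : NotAbove T w) where
    private
      lifted : Lift (n + n) 0 w T (toMatching 0 w T)
      lifted = subst (λ N → Lift N 0 w T (toMatching 0 w T)) (proj₁ dw)
        (lift 0 w (dyck⇒ballot dT) (under T w (trans (proj₁ dT) (sym (proj₁ dw))) na) (dyck⇒ballot dw))
      open Lift lifted renaming (path to toPath-eq)
      r : Rep (matching w T) (toMatching 0 w T)
      r = toVec-rep (Mat.bound mat)

    matching-valid : IsMatching w (matching w T)
    matching-valid = let pm , sh = mat-rep r mat in pm , sh , Equivalence.from (avoids r) avoid

    path-matching : path w (matching w T) ≡ T
    -- The round trip through a vector preserves the function only below `n + n`, which suffices for
    -- the path.
    path-matching = trans (sym (toPath-cong w mat (rep-unique r (toFun-rep (matching w T))))) toPath-eq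

  Δ : (F : Ferrers n) → ℳ n F τ ↔ D² n F
  Δ F@(w , [ dw ]) = mk↔ₛ′ to from to-from from-to
    where
    to : ℳ n F τ → D² n F
    to (m , [ pm ]) = ((path w m , [ path-dyck w m pm ]) , F) , [ refl , path-under w m pm ]

    from : D² n F → ℳ n F τ
    from (((T , [ dT ]) , _) , [ p ]) =
      matching w T , [ matching-valid w T dw dT (subst (NotAbove T) (cong value (proj₁ p)) (proj₂ p)) ]

    to-from : ∀ p → to (from p) ≡ p
    -- The membership proofs are irrelevant, so equations derived from them are made relevant by
    -- deciding equality of words.
    to-from (((T , [ dT ]) , (w′ , [ _ ])) , [ p ]) = value-injective (cong₂ _,_
      (value-injective (recompute (List.≡-dec _≟-step_ _ _)
        (path-matching w T dw dT (subst (NotAbove T) (cong value (proj₁ p)) (proj₂ p)))))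
      (value-injective (recompute (List.≡-dec _≟-step_ _ _) (sym (cong value (proj₁ p))))))

    from-to : ∀ m → from (to m) ≡ m
    from-to (m , [ pm ]) = value-injective (recompute (Vec.≡-dec Fin._≟_ _ _) (matching-path w m pm))

theorem3p1 : (∀ (n : ℕ) (F : Ferrers n) →
    (ℳ n F τ321 ⤖ D² n F) × (ℳ n F τ213 ⤖ D² n F))
    × ShapeWilfEquivalent τ321 τ213
theorem3p1 = (λ n F → ↔⇒⤖ (Δ321 n F) , ↔⇒⤖ (Δ213 n F))
           , λ n F → ↔⇒⤖ (↔-trans (Δ321 n F) (↔-sym (Δ213 n F)))
  where
  Δ321 : ∀ n F → ℳ n F τ321 ↔ D² n F
  Δ321 = Δ rule321 {τ = τ321} avoids321
  Δ213 : ∀ n F → ℳ n F τ213 ↔ D² n F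
  Δ213 = Δ rule213 {τ = τ213} avoids213
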